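{- For every integer $n\ge 3$, the path $P_n$ on $n$ vertices satisfies \[ \operatorname{st}_{\gamma_{st}}(P_n)=\begin{cases}1,& \text{if } n\equiv 0,1 \pmod 3,\\ 2,& \text{if } n\equiv 2 \pmod 3.\end{cases} \]
   Context: All graphs are finite, simple and undirected. For a graph $G=(V,E)$, a set $D\subseteq V$ is a strong dominating set if every vertex $v\in V\setminus D$ is adjacent to some $u\in D$ with $\deg(v)\le\deg(u)$ (degrees taken in $G$). The strong domination number $\gamma_{st}(G)$ is the minimum size of a strong dominating set. For $S\subseteq V$, $G-S$ is the graph obtained by deleting the vertices of $S$. The stability of the strong domination number is $\operatorname{st}_{\gamma_{st}}(G)=\min\{|S| : S\subseteq V,\ \gamma_{st}(G-S)\ne\gamma_{st}(G)\}$. -}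

module Defs where

open import Data.Fin using (Fin; toℕ)
import Data.Fin.Properties as Fin
open import Data.Fin.Subset
  using (Subset; _∈_; _∉_; _⊆_; _─_; ⊤; ⊥; ∣_∣; inside; outside; Nonempty)
open import Data.Fin.Subset.Properties
  using ( _∈?_; _⊆?_; anySubset?; ∣p∣≤n; ∈⊤; ⊥⊆; ∣⊥∣≡0; ⊆-refl
        ; x∈p∧x∉q⇒x∈p─q; x∈p⇒∣p-x∣<∣p∣; p─q⊆p)
open import Data.Nat using (ℕ; zero; suc; _≤_; _≤?_; z≤n; s≤s)
open import Data.Nat.Properties using (_≟_; 1+n≢n; n≤0⇒n≡0; m<n⇒n≢0; ≤-trans; ≤-reflexive)
open import Data.Product using (∃; _×_; _,_; proj₁)
open import Data.Sum using (_⊎_; inj₁; inj₂; swap)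
open import Data.Vec using (tabulate; _∷_; there)
open import Function using (_∘_)
open import Level using (0ℓ)
open import Relation.Binary.PropositionalEquality
  using (_≡_; _≢_; refl; sym; trans)
open import Relation.Nullary using (Dec; yes; no; does; ¬_; ¬?; contradiction)
open import Relation.Nullary.Decidable using (_×-dec_; _→-dec_; _⊎-dec_)
open import Relation.Unary using (Pred; Decidable)

-- The vertex set is an arbitrary subset of an ambient Fin m, so that
-- deleting vertices does not require renumbering the remaining ones.
record Graph (m : ℕ) : Set₁ where
  field
    V         : Subset m
    Adj       : Fin m → Fin m → Set
    adj?      : ∀ u v → Dec (Adj u v)
    adj-sym   : ∀ {u v} → Adj u v → Adj v u
    adj-irr   : ∀ {v} → ¬ Adj v v
    adj-V     : ∀ {u v} → Adj u v → u ∈ V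

  neighbours : Fin m → Subset m
  neighbours v = tabulate (λ u → does (adj? v u))

  deg : Fin m → ℕ
  deg v = ∣ neighbours v ∣

open Graph

x∈p─q⇒x∉q : ∀ {n} (p q : Subset n) {x} → x ∈ p ─ q → x ∉ q
x∈p─q⇒x∉q (_ ∷ p) (inside  ∷ q) (there x∈) (there x∈q) = x∈p─q⇒x∉q p q x∈ x∈q
x∈p─q⇒x∉q (_ ∷ p) (outside ∷ q) (there x∈) (there x∈q) = x∈p─q⇒x∉q p q x∈ x∈q

infixl 5 _∖_

_∖_ : ∀ {m} → Graph m → Subset m → Graph m
G ∖ S = record
  { V       = V G ─ S
  ; Adj     = λ u v → Adj G u v × u ∉ S × v ∉ S
  ; adj?    = λ u v → adj? G u v ×-dec ¬? (u ∈? S) ×-dec ¬? (v ∈? S)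
  ; adj-sym = λ (a , u∉S , v∉S) → adj-sym G a , v∉S , u∉S
  ; adj-irr = adj-irr G ∘ proj₁
  ; adj-V   = λ (a , u∉S , _) → x∈p∧x∉q⇒x∈p─q (adj-V G a) u∉S
  }

Path : ∀ n → Graph n
Path n = record
  { V       = ⊤
  ; Adj     = λ u v → toℕ v ≡ suc (toℕ u) ⊎ toℕ u ≡ suc (toℕ v)
  ; adj?    = λ u v → (toℕ v ≟ suc (toℕ u)) ⊎-dec (toℕ u ≟ suc (toℕ v))
  ; adj-sym = swap
  ; adj-irr = λ { (inj₁ e) → 1+n≢n (sym e) ; (inj₂ e) → 1+n≢n (sym e) }
  ; adj-V   = λ _ → ∈⊤
  }

-- The least k < b satisfying P, or b if there is none.
least : ∀ {P : Pred ℕ 0ℓ} → Decidable P → ℕ → ℕ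
least P? zero    = 0
least P? (suc b) with P? 0
... | yes _ = 0
... | no  _ = suc (least (P? ∘ suc) b)

least-sat : ∀ {P : Pred ℕ 0ℓ} (P? : Decidable P) {b k} →
            k ≤ b → P k → P (least P? b)
least-sat P? {zero}  z≤n p = p
least-sat P? {suc b} k≤b p with P? 0
... | yes p₀ = p₀
least-sat P? {suc b} z≤n       p | no ¬p₀ = contradiction p ¬p₀
least-sat P? {suc b} (s≤s k≤b) p | no _   = least-sat (P? ∘ suc) k≤b p

least-min : ∀ {P : Pred ℕ 0ℓ} (P? : Decidable P) b {k} → P k → least P? b ≤ k
least-min P? zero    p = z≤n
least-min P? (suc b) p with P? 0
... | yes _ = z≤n
least-min P? (suc b) {zero}  p | no ¬p₀ = contradiction p ¬p₀
least-min P? (suc b) {suc k} p | no _   = s≤s (least-min (P? ∘ suc) b p)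

module _ {m} {P : Pred (Subset m) 0ℓ} (P? : Decidable P) where

  private
    ofSize? : Decidable (λ k → ∃ λ p → P p × ∣ p ∣ ≡ k)
    ofSize? k = anySubset? (λ p → P? p ×-dec (∣ p ∣ ≟ k))

  -- The minimum size of a subset satisfying P; the value is m (junk) when no
  -- subset does.
  minSize : ℕ
  minSize = least ofSize? m

  minSize-attained : ∃ P → ∃ λ p → P p × ∣ p ∣ ≡ minSize
  minSize-attained (p , Pp) = least-sat ofSize? (∣p∣≤n p) (p , Pp , refl)

  minSize-lower : ∀ {p} → P p → minSize ≤ ∣ p ∣
  minSize-lower Pp = least-min ofSize? m (_ , Pp , refl)

module _ {m} (G : Graph m) where

  StrongDominating : Subset m → Set
  StrongDominating D =
    D ⊆ V G ×
    (∀ v → v ∈ V G → v ∉ D → ∃ λ u → u ∈ D × Adj G v u × deg G v ≤ deg G u)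

  strongDominating? : Decidable StrongDominating
  strongDominating? D =
    (D ⊆? V G) ×-dec
    Fin.all? (λ v → (v ∈? V G) →-dec ¬? (v ∈? D) →-dec
      Fin.any? (λ u → (u ∈? D) ×-dec adj? G v u ×-dec (deg G v ≤? deg G u)))

  V-strongDominating : StrongDominating (V G)
  V-strongDominating = ⊆-refl , λ v v∈V v∉V → contradiction v∈V v∉V

  γst : ℕ
  γst = minSize strongDominating?

  γst-attained : ∃ λ D → StrongDominating D × ∣ D ∣ ≡ γst
  γst-attained = minSize-attained strongDominating? (V G , V-strongDominating)

  γst-lower : ∀ {D} → StrongDominating D → γst ≤ ∣ D ∣
  γst-lower = minSize-lower strongDominating?

module _ {m} (G : Graph m) where

  ChangesγSt : Subset m → Set
  ChangesγSt S = S ⊆ V G × γst (G ∖ S) ≢ γst G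

  changesγSt? : Decidable ChangesγSt
  changesγSt? S = (S ⊆? V G) ×-dec ¬? (γst (G ∖ S) ≟ γst G)

  V-changesγSt : Nonempty (V G) → ChangesγSt (V G)
  V-changesγSt (v , v∈V) = ⊆-refl , λ eq → γst≢0 (trans (sym eq) γst-empty≡0)
    where
    ∣p∣≡0⇒∉ : ∀ {p : Subset m} → ∣ p ∣ ≡ 0 → ∀ {x} → x ∉ p
    ∣p∣≡0⇒∉ eq x∈p = m<n⇒n≢0 (x∈p⇒∣p-x∣<∣p∣ x∈p) eq

    γst≢0 : γst G ≢ 0
    γst≢0 eq with γst-attained G
    ... | D , (_ , dom) , ∣D∣≡γ with dom v v∈V (∣p∣≡0⇒∉ (trans ∣D∣≡γ eq))
    ...   | _ , u∈D , _ = ∣p∣≡0⇒∉ (trans ∣D∣≡γ eq) u∈D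

    γst-empty≡0 : γst (G ∖ V G) ≡ 0
    γst-empty≡0 = n≤0⇒n≡0 (≤-trans (γst-lower (G ∖ V G) ⊥-dominating)
                                    (≤-reflexive (∣⊥∣≡0 m)))
      where
      ⊥-dominating : StrongDominating (G ∖ V G) ⊥
      ⊥-dominating = ⊥⊆ , λ x x∈V─V _ →
        contradiction (p─q⊆p (V G) (V G) x∈V─V) (x∈p─q⇒x∉q (V G) (V G) x∈V─V)

  -- By V-changesγSt this is a minimum over a nonempty family, unless G has no
  -- vertices at all.
  stability : ℕ
  stability = minSize changesγSt?

  stability-attained : Nonempty (V G) → ∃ λ S → ChangesγSt S × ∣ S ∣ ≡ stability
  stability-attained ne = minSize-attained changesγSt? (V G , V-changesγSt ne)

  stability-lower : ∀ {S} → ChangesγSt S → stability ≤ ∣ S ∣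
  stability-lower = minSize-lower changesγSt?

{-# OPTIONS --safe #-}
-- Lower bounds on γst come from packings: vertices with pairwise disjoint closed
-- neighbourhoods.  Upper bounds come from cutting what remains of the path into
-- triples, each dominated by its centre, around a short middle piece that
-- contains the deleted vertices.
-- Write n = r + 3k.  For r = 0, deleting vertex 1 raises γst from k to k + 1; for
-- r = 1, deleting vertex 0 lowers it from k + 1 to k; for r = 2, deleting vertices
-- 0 and 1 lowers it from k + 1 to k, while no single deletion changes it.
module Submission where

open import Defs
open import Data.Fin using (Fin; toℕ; fromℕ<; zero; suc)
open import Data.Fin.Properties using (toℕ-fromℕ<; toℕ-injective; toℕ<n)
open import Data.Fin.Subset
  using (Subset; _∈_; _∉_; _⊆_; _-_; _∪_; ⊤; ⊥; ⁅_⁆; ∣_∣; inside; outside; Nonempty)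
open import Data.Fin.Subset.Properties
open import Data.List using (List; []; _∷_; _++_; length; applyUpTo)
open import Data.List.Membership.Propositional using () renaming (_∈_ to _∈ˡ_)
open import Data.List.Membership.Propositional.Properties
  using (∈-++⁺ˡ; ∈-++⁺ʳ; ∈-++⁻; ∈-applyUpTo⁺; ∈-applyUpTo⁻)
open import Data.Nat.Properties
open import Data.List.Membership.DecPropositional _≟_ using () renaming (_∈?_ to _∈ˡ?_)
open import Data.List.Properties using (length-++; length-applyUpTo)
open import Data.List.Relation.Unary.Any using (here; there)
open import Data.Nat
  using (ℕ; zero; suc; pred; _+_; _*_; _∸_; _≤_; _<_; _<?_; z≤n; s≤s; z<s; s<s; s≤s⁻¹; _%_; _/_)
open import Data.Nat.DivMod
  using (m≡m%n+[m/n]*n; m%n<n; m/n*n≤m; [m+kn]%n≡m%n; +-distrib-/-∣ʳ; m*n/n≡m)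
open import Data.Nat.Divisibility using (n∣m*n)
open import Data.Nat.Tactic.RingSolver using (solve-∀)
open import Data.Product using (∃; _×_; _,_; proj₁; proj₂)
open import Data.Sum using (_⊎_; inj₁; inj₂; [_,_]′)
open import Data.Vec using (tabulate; []; _∷_)
open import Data.Vec.Properties using (lookup∘tabulate; lookup⇒[]=; []=⇒lookup)
open import Function using (_∘_; id)
open import Level using (0ℓ)
open import Relation.Binary.PropositionalEquality
  using (_≡_; _≢_; refl; sym; trans; cong; cong₂; subst; subst₂; module ≡-Reasoning)
open import Relation.Nullary using (yes; no; does; contradiction)
open import Relation.Nullary.Decidable using (dec-true)
open import Relation.Unary using (Pred; Decidable)

open Graph

-- Finite subsets and their sizes

private
  variable
    n : ℕ

∈-tabulate⁺ : {P : Pred (Fin n) 0ℓ} (P? : Decidable P) {x : Fin n} →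
              P x → x ∈ tabulate (does ∘ P?)
∈-tabulate⁺ P? {x} px =
  lookup⇒[]= x _ (trans (lookup∘tabulate (does ∘ P?) x) (dec-true (P? x) px))

∈-tabulate⁻ : {P : Pred (Fin n) 0ℓ} (P? : Decidable P) {x : Fin n} →
              x ∈ tabulate (does ∘ P?) → P x
∈-tabulate⁻ P? {x} x∈ with P? x | trans (sym (lookup∘tabulate (does ∘ P?) x)) ([]=⇒lookup x∈)
... | yes px | _  = px
... | no _   | ()

x∈p⇒0<∣p∣ : {p : Subset n} {x : Fin n} → x ∈ p → 0 < ∣ p ∣
x∈p⇒0<∣p∣ x∈p = ≤-<-trans z≤n (x∈p⇒∣p-x∣<∣p∣ x∈p)

x≢y⇒1<∣p∣ : {p : Subset n} {x y : Fin n} → x ∈ p → y ∈ p → x ≢ y → 1 < ∣ p ∣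
x≢y⇒1<∣p∣ x∈p y∈p x≢y =
  ≤-<-trans (x∈p⇒0<∣p∣ (x∈p∧x≢y⇒x∈p-y x∈p x≢y)) (x∈p⇒∣p-x∣<∣p∣ y∈p)

∣p∪q∣≤∣p∣+∣q∣ : (p q : Subset n) → ∣ p ∪ q ∣ ≤ ∣ p ∣ + ∣ q ∣
∣p∪q∣≤∣p∣+∣q∣ []            []            = z≤n
∣p∪q∣≤∣p∣+∣q∣ (outside ∷ p) (outside ∷ q) = ∣p∪q∣≤∣p∣+∣q∣ p q
∣p∪q∣≤∣p∣+∣q∣ (outside ∷ p) (inside  ∷ q) =
  ≤-trans (s≤s (∣p∪q∣≤∣p∣+∣q∣ p q)) (≤-reflexive (sym (+-suc ∣ p ∣ ∣ q ∣)))
∣p∪q∣≤∣p∣+∣q∣ (inside  ∷ p) (outside ∷ q) = s≤s (∣p∪q∣≤∣p∣+∣q∣ p q)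
∣p∪q∣≤∣p∣+∣q∣ (inside  ∷ p) (inside  ∷ q) =
  s≤s (≤-trans (∣p∪q∣≤∣p∣+∣q∣ p q) (+-monoʳ-≤ ∣ p ∣ (n≤1+n ∣ q ∣)))

∣p∣≤1+∣p-x∣ : (p : Subset n) (x : Fin n) → ∣ p ∣ ≤ suc ∣ p - x ∣
∣p∣≤1+∣p-x∣ p x = ≤-trans (p⊆q⇒∣p∣≤∣q∣ split)
  (≤-trans (∣p∪q∣≤∣p∣+∣q∣ ⁅ x ⁆ (p - x)) (≤-reflexive (cong (_+ ∣ p - x ∣) (∣⁅x⁆∣≡1 x))))
  where
  split : p ⊆ ⁅ x ⁆ ∪ (p - x)
  split {v} v∈p with v ∈? ⁅ x ⁆
  ... | yes v∈x = x∈p∪q⁺ (inj₁ v∈x)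
  ... | no v∉x  = x∈p∪q⁺ (inj₂ (x∈p∧x∉q⇒x∈p─q v∈p v∉x))

-- Removing one vertex from `p` pays for each entry of `xs`, and an entry that is not below `n`
-- matches no vertex. Repeated and out-of-range entries only weaken the bound, so it serves both for
-- degrees and for dominating sets given by positions.
∣p∣≤length : (xs : List ℕ) {p : Subset n} →
             (∀ {v} → v ∈ p → toℕ v ∈ˡ xs) → ∣ p ∣ ≤ length xs
∣p∣≤length {n} [] {p} ⊆xs with nonempty? p
... | yes (v , v∈p) = contradiction (⊆xs v∈p) λ ()
... | no empty      = ≤-reflexive (trans (cong ∣_∣ (Empty-unique empty)) (∣⊥∣≡0 n))
∣p∣≤length {n} (x ∷ xs) {p} ⊆xs with x <? n
... | no x≮n = m≤n⇒m≤1+n (∣p∣≤length xs λ v∈p → drop-x (⊆xs v∈p))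
  where
  drop-x : ∀ {v : Fin n} → toℕ v ∈ˡ x ∷ xs → toℕ v ∈ˡ xs
  drop-x {v} (here refl) = contradiction (toℕ<n v) x≮n
  drop-x (there v∈)      = v∈
... | yes x<n = ≤-trans (∣p∣≤1+∣p-x∣ p w) (s≤s (∣p∣≤length xs λ v∈p-w →
    drop-x v∈p-w (⊆xs (p─q⊆p p ⁅ w ⁆ v∈p-w))))
  where
  w : Fin n
  w = fromℕ< x<n

  drop-x : ∀ {v} → v ∈ p - w → toℕ v ∈ˡ x ∷ xs → toℕ v ∈ˡ xs
  drop-x {v} v∈ (here v≡x) = contradiction
    (subst (_∈ ⁅ w ⁆) (toℕ-injective (trans (toℕ-fromℕ< x<n) (sym v≡x))) (x∈⁅x⁆ w))
    (x∈p─q⇒x∉q p ⁅ w ⁆ v∈)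
  drop-x v∈ (there v∈xs) = v∈xs

-- Members of different classes are different. Removing the member found in the top class keeps
-- those found in the lower classes, so induction on `t` applies.
meets-classes⇒≤∣p∣ : (class : Fin n → ℕ) (t : ℕ) {p : Subset n} →
                     (∀ {i} → i < t → ∃ λ v → v ∈ p × class v ≡ i) → t ≤ ∣ p ∣
meets-classes⇒≤∣p∣ class zero    meets = z≤n
meets-classes⇒≤∣p∣ class (suc t) meets with meets (n<1+n t)
... | w , w∈p , cw≡t = ≤-<-trans
  (meets-classes⇒≤∣p∣ class t λ i<t → let (v , v∈p , cv≡i) = meets (m<n⇒m<1+n i<t) in
    v , x∈p∧x≢y⇒x∈p-y v∈p (λ v≡w → <⇒≢ i<t (trans (sym cv≡i) (trans (cong class v≡w) cw≡t)))
      , cv≡i)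
  (x∈p⇒∣p-x∣<∣p∣ w∈p)

∣p∣≡0⇒p≡⊥ : {p : Subset n} → ∣ p ∣ ≡ 0 → p ≡ ⊥
∣p∣≡0⇒p≡⊥ ∣p∣≡0 = Empty-unique λ (v , v∈p) → m<n⇒n≢0 (x∈p⇒0<∣p∣ v∈p) ∣p∣≡0

∣p∣≤1⇒⊥⊎⁅⁆ : {p : Subset n} → ∣ p ∣ ≤ 1 → p ≡ ⊥ ⊎ ∃ λ v → p ≡ ⁅ v ⁆
∣p∣≤1⇒⊥⊎⁅⁆ {p = p} ∣p∣≤1 with nonempty? p
... | no empty      = inj₁ (Empty-unique empty)
... | yes (v , v∈p) = inj₂ (v , ⊆-antisym p⊆⁅v⁆ ⁅v⁆⊆p)
  where
  p⊆⁅v⁆ : p ⊆ ⁅ v ⁆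
  p⊆⁅v⁆ {u} u∈p with u ∈? ⁅ v ⁆
  ... | yes u∈ = u∈
  ... | no u∉  = contradiction (x≢y⇒1<∣p∣ u∈p v∈p (x∉⁅y⁆⇒x≢y u∉)) (≤⇒≯ ∣p∣≤1)

  ⁅v⁆⊆p : ⁅ v ⁆ ⊆ p
  ⁅v⁆⊆p u∈ = subst (_∈ p) (sym (x∈⁅y⁆⇒x≡y v u∈)) v∈p

-- Lists of naturals allow dominating sets to be assembled by concatenation and arithmetic on
-- positions, without bound proofs for the entries.
positions : List ℕ → Subset n
positions xs = tabulate (λ u → does (toℕ u ∈ˡ? xs))

∈-positions⁺ : ∀ {xs} {u : Fin n} → toℕ u ∈ˡ xs → u ∈ positions xs
∈-positions⁺ {xs = xs} = ∈-tabulate⁺ (λ u → toℕ u ∈ˡ? xs)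

∈-positions⁻ : ∀ {xs} {u : Fin n} → u ∈ positions xs → toℕ u ∈ˡ xs
∈-positions⁻ {xs = xs} = ∈-tabulate⁻ (λ u → toℕ u ∈ˡ? xs)

-- Strong domination in general graphs

module _ (G : Graph n) where

  -- A positive form of the domination condition: it is monotone in `D`, so pieces of the graph can
  -- be treated separately and combined.
  Covered : Subset n → Fin n → Set
  Covered D v = v ∈ D ⊎ ∃ λ u → u ∈ D × Adj G v u × deg G v ≤ deg G u

  Covered-mono : ∀ {D D′ v} → D ⊆ D′ → Covered D v → Covered D′ v
  Covered-mono D⊆D′ (inj₁ v∈D)           = inj₁ (D⊆D′ v∈D)
  Covered-mono D⊆D′ (inj₂ (u , u∈D , h)) = inj₂ (u , D⊆D′ u∈D , h)

  covered⇒strongDominating : ∀ {D} → D ⊆ V G → (∀ {v} → v ∈ V G → Covered D v) →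
                             StrongDominating G D
  covered⇒strongDominating D⊆V covered = D⊆V , λ v v∈V v∉D →
    [ (λ v∈D → contradiction v∈D v∉D) , id ]′ (covered v∈V)

  ∈-neighbours⁺ : ∀ {u v} → Adj G v u → u ∈ neighbours G v
  ∈-neighbours⁺ {v = v} = ∈-tabulate⁺ (adj? G v)

  ∈-neighbours⁻ : ∀ {u v} → u ∈ neighbours G v → Adj G v u
  ∈-neighbours⁻ {v = v} = ∈-tabulate⁻ (adj? G v)

  -- A vertex with a single neighbour has degree at most 1, while that neighbour has degree at least
  -- 1, since it sees the leaf.
  leaf-covered : ∀ {D v u} → u ∈ D → Adj G v u → (∀ {w} → Adj G v w → w ≡ u) →
                 Covered D v
  leaf-covered u∈D vu only = inj₂ (_ , u∈D , vu , ≤-trans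
    (∣p∣≤length (_ ∷ []) λ w∈ → here (cong toℕ (only (∈-neighbours⁻ w∈))))
    (x∈p⇒0<∣p∣ (∈-neighbours⁺ (adj-sym G vu))))

  -- A strong dominating set meets the closed neighbourhood of every vertex. Disjointness of the
  -- chosen neighbourhoods is encoded by `class`: each lies inside its own class, so each forces a
  -- separate member.
  packing≤γst : (class : Fin n → ℕ) (t : ℕ) →
    (∀ {i} → i < t → ∃ λ v → v ∈ V G × class v ≡ i × (∀ {u} → Adj G v u → class u ≡ i)) →
    t ≤ γst G
  packing≤γst class t packing with γst-attained G
  ... | D , (_ , dominates) , ∣D∣≡γ =
    subst (t ≤_) ∣D∣≡γ (meets-classes⇒≤∣p∣ class t meets)
    where
    meets : ∀ {i} → i < t → ∃ λ u → u ∈ D × class u ≡ i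
    meets i<t with packing i<t
    ... | v , v∈V , cv , cN with v ∈? D
    ...   | yes v∈D = v , v∈D , cv
    ...   | no v∉D  = let (u , u∈D , vu , _) = dominates v v∈V v∉D in u , u∈D , cN vu

-- Stands in for equality of graphs when the adjacency types are only logically equivalent. The
-- neighbourhoods include each other, so the degree comparisons carry over.
strongDominating-transfer : (G H : Graph n) → V G ≡ V H →
  (∀ {u v} → Adj G u v → Adj H u v) → (∀ {u v} → Adj H u v → Adj G u v) →
  ∀ {D} → StrongDominating G D → StrongDominating H D
strongDominating-transfer G H V≡ to from {D} (D⊆V , dominates) =
  subst (D ⊆_) V≡ D⊆V ,
  λ v v∈V v∉D → let (u , u∈D , vu , le) = dominates v (subst (v ∈_) (sym V≡) v∈V) v∉D in
    u , u∈D , to vu ,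
    ≤-trans (deg-mono H G from v) (≤-trans le (deg-mono G H to u))
  where
  deg-mono : (G H : Graph _) → (∀ {u v} → Adj G u v → Adj H u v) →
             ∀ v → deg G v ≤ deg H v
  deg-mono G H f v = p⊆q⇒∣p∣≤∣q∣ (∈-neighbours⁺ H ∘ f ∘ ∈-neighbours⁻ G)

-- Lets bounds that are proved for paths with deleted vertices be used, at `⊥`, for the path itself.
γst-∖⊥ : (G : Graph n) → γst (G ∖ ⊥) ≡ γst G
γst-∖⊥ G = ≤-antisym
  (bound (G ∖ ⊥) G (p─⊥≡p (V G)) proj₁ (λ a → a , ∉⊥ , ∉⊥))
  (bound G (G ∖ ⊥) (sym (p─⊥≡p (V G))) (λ a → a , ∉⊥ , ∉⊥) proj₁)
  where
  bound : (G H : Graph _) → V G ≡ V H → (∀ {u v} → Adj G u v → Adj H u v) →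
          (∀ {u v} → Adj H u v → Adj G u v) → γst G ≤ γst H
  bound G H V≡ to from with γst-attained H
  ... | D , sd , ∣D∣≡γ = subst (γst G ≤_) ∣D∣≡γ
    (γst-lower G (strongDominating-transfer H G (sym V≡) from to sd))

-- Criteria for the value of the stability

stability≢0 : (G : Graph n) → Nonempty (V G) → stability G ≢ 0
stability≢0 G ne st≡0 =
  let S , (_ , changes) , ∣S∣≡st = stability-attained G ne in
  changes (trans (cong (λ S → γst (G ∖ S)) (∣p∣≡0⇒p≡⊥ (trans ∣S∣≡st st≡0))) (γst-∖⊥ G))

stability≡1 : (G : Graph n) {v : Fin n} → v ∈ V G → γst (G ∖ ⁅ v ⁆) ≢ γst G →
              stability G ≡ 1
stability≡1 G {v} v∈V changes = ≤-antisym
  (subst (stability G ≤_) (∣⁅x⁆∣≡1 v)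
    (stability-lower G ((λ u∈ → subst (_∈ V G) (sym (x∈⁅y⁆⇒x≡y v u∈)) v∈V) , changes)))
  (n≢0⇒n>0 (stability≢0 G (v , v∈V)))

-- A set attaining a stability of at most 1 would be empty or a singleton, and deleting either
-- leaves `γst` as it was.
1<stability : (G : Graph n) → Nonempty (V G) → (∀ v → γst (G ∖ ⁅ v ⁆) ≡ γst G) →
              1 < stability G
1<stability G ne unchanged = ≰⇒> λ st≤1 →
  let S , (_ , changes) , ∣S∣≡st = stability-attained G ne in
  changes (same (∣p∣≤1⇒⊥⊎⁅⁆ (subst (_≤ 1) (sym ∣S∣≡st) st≤1)))
  where
  same : ∀ {S} → S ≡ ⊥ ⊎ (∃ λ v → S ≡ ⁅ v ⁆) → γst (G ∖ S) ≡ γst G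
  same (inj₁ S≡⊥)       = trans (cong (λ S → γst (G ∖ S)) S≡⊥) (γst-∖⊥ G)
  same (inj₂ (v , S≡v)) = trans (cong (λ S → γst (G ∖ S)) S≡v) (unchanged v)

-- Paths with some vertices deleted

[s+i*3]/3 : ∀ s i → (s + i * 3) / 3 ≡ s / 3 + i
[s+i*3]/3 s i = trans (+-distrib-/-∣ʳ s (n∣m*n i)) (cong (s / 3 +_) (m*n/n≡m i 3))

residue-unique : ∀ s s′ i i′ → s + i * 3 ≡ s′ + i′ * 3 → s % 3 ≡ s′ % 3
residue-unique s s′ i i′ eq =
  trans (sym ([m+kn]%n≡m%n s i 3)) (trans (cong (_% 3) eq) ([m+kn]%n≡m%n s′ i′ 3))

vertex : ∀ {a} → a < n → ∃ λ (v : Fin n) → toℕ v ≡ a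
vertex a<n = fromℕ< a<n , toℕ-fromℕ< a<n

module _ (S : Subset n) where

  private
    G : Graph n
    G = Path n ∖ S

  ∉⇒∈V : ∀ {v} → v ∉ S → v ∈ V G
  ∉⇒∈V = x∈p∧x∉q⇒x∈p─q ∈⊤

  ∈V⇒∉ : ∀ {v} → v ∈ V G → v ∉ S
  ∈V⇒∉ = x∈p─q⇒x∉q ⊤ S

  -- Cuts the path into blocks of three consecutive positions. The shift `e` moves the cuts: the
  -- block centres are 1, 4, 7, ... for `e = 0`, then 0, 3, 6, ... for `e = 1`, and 2, 5, 8, ...
  -- (from block 1 on) for `e = 2`.
  class : ℕ → Fin n → ℕ
  class e u = (toℕ u + e) / 3

  -- The equation places `v` at the centre of block `i`, and its possible neighbours are the two
  -- outer positions of the same block.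
  path-packing : ∀ e i {v} → toℕ v + e ≡ 1 + i * 3 → v ∉ S →
    v ∈ V G × class e v ≡ i × (∀ {u} → Adj G v u → class e u ≡ i)
  path-packing e i {v} eq v∉S = ∉⇒∈V v∉S , in-class 1 refl eq , λ where
      (inj₁ u≡1+v , _) → in-class 2 refl (trans (cong (_+ e) u≡1+v) (cong suc eq))
      (inj₂ v≡1+u , _) → in-class 0 refl (cong pred (trans (cong (_+ e) (sym v≡1+u)) eq))
    where
    in-class : ∀ s {x} → s / 3 ≡ 0 → x + e ≡ s + i * 3 → (x + e) / 3 ≡ i
    in-class s s/3≡0 x+e≡ =
      trans (cong (_/ 3) x+e≡) (trans ([s+i*3]/3 s i) (cong (_+ i) s/3≡0))

  -- Upper bounds from triples

  deg≤2 : ∀ v → deg G v ≤ 2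
  -- For vertex 0 the entry `pred (toℕ v)` is 0 itself, which is harmless in an upper bound.
  deg≤2 v = ∣p∣≤length (suc (toℕ v) ∷ pred (toℕ v) ∷ []) λ u∈ → ends (∈-neighbours⁻ G u∈)
    where
    ends : ∀ {u} → Adj G v u → toℕ u ∈ˡ suc (toℕ v) ∷ pred (toℕ v) ∷ []
    ends (inj₁ u≡1+v , _) = here u≡1+v
    ends (inj₂ v≡1+u , _) = there (here (cong pred (sym v≡1+u)))

  -- With both neighbours present the centre has degree 2, the maximum in a path, so the degree
  -- condition holds towards either end.
  centre-covers : ∀ {D a c b} → toℕ c ≡ suc (toℕ a) → toℕ b ≡ suc (toℕ c) →
                  a ∉ S → c ∉ S → b ∉ S → c ∈ D → Covered G D a × Covered G D b
  centre-covers {a = a} {c} {b} c≡1+a b≡1+c a∉S c∉S b∉S c∈D =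
    inj₂ (c , c∈D , adj-sym G ca , ≤-trans (deg≤2 a) 2≤deg) ,
    inj₂ (c , c∈D , adj-sym G cb , ≤-trans (deg≤2 b) 2≤deg)
    where
    ca : Adj G c a
    ca = inj₂ c≡1+a , c∉S , a∉S

    cb : Adj G c b
    cb = inj₁ b≡1+c , c∉S , b∉S

    a≢b : a ≢ b
    a≢b refl = m≢1+n+m (toℕ a) (trans b≡1+c (cong suc c≡1+a))

    2≤deg : 2 ≤ deg G c
    2≤deg = x≢y⇒1<∣p∣ (∈-neighbours⁺ G ca) (∈-neighbours⁺ G cb) a≢b

  triple-covered : ∀ {D a} → 2 + a < n →
    (∀ {w} → a ≤ toℕ w → toℕ w < 3 + a → w ∉ S) →
    (∀ {w} → toℕ w ≡ 1 + a → w ∈ D) →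
    ∀ {v} s → s < 3 → toℕ v ≡ s + a → Covered G D v
  triple-covered {a = a} 2+a<n free centre∈D {v} s s<3 v≡
    with vertex (≤-trans (n≤1+n _) (≤-trans (n≤1+n _) 2+a<n)) | vertex (≤-trans (n≤1+n _) 2+a<n)
       | vertex 2+a<n
  ... | x , x≡ | y , y≡ | z , z≡
    with centre-covers (trans y≡ (cong suc (sym x≡))) (trans z≡ (cong suc (sym y≡)))
           (in-triple 0 z<s x≡) (in-triple 1 (s<s z<s) y≡) (in-triple 2 (s<s (s<s z<s)) z≡)
           (centre∈D y≡)
    where
    in-triple : ∀ s {w} → s < 3 → toℕ w ≡ s + a → w ∉ S
    in-triple s s<3 w≡ = free (≤-trans (m≤n+m a s) (≤-reflexive (sym w≡)))
                              (≤-trans (s≤s (≤-reflexive w≡)) (+-monoˡ-≤ a s<3))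
  triple-covered _ _ centre∈D 0 _ v≡ | x , x≡ | _ | _ | cx , _ =
    subst (Covered G _) (toℕ-injective (trans x≡ (sym v≡))) cx
  triple-covered _ _ centre∈D 1 _ v≡ | _ | _ | _ | _ = inj₁ (centre∈D v≡)
  triple-covered _ _ centre∈D 2 _ v≡ | _ | _ | z , z≡ | _ , cz =
    subst (Covered G _) (toℕ-injective (trans z≡ (sym v≡))) cz
  triple-covered _ _ _ (suc (suc (suc _))) (s≤s (s≤s (s≤s ()))) _ | _ | _ | _ | _

  -- The grouping `1 + (i * 3 + a)` matches the centre in `triple-covered` for the triple starting
  -- at `i * 3 + a`.
  centres : ℕ → ℕ → List ℕ
  centres a t = applyUpTo (λ i → 1 + (i * 3 + a)) t

  i<t⇒3+i*3+a≤t*3+a : ∀ {i t} a → i < t → 3 + (i * 3 + a) ≤ t * 3 + a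
  i<t⇒3+i*3+a≤t*3+a a i<t = +-monoˡ-≤ a (*-monoˡ-≤ 3 i<t)

  centre-free : ∀ a t → (∀ {w} → a ≤ toℕ w → toℕ w < t * 3 + a → w ∉ S) →
                ∀ {w : Fin n} → toℕ w ∈ˡ centres a t → w ∉ S
  centre-free a t free w∈ with ∈-applyUpTo⁻ (λ i → 1 + (i * 3 + a)) w∈
  ... | i , i<t , w≡ = free
    (≤-trans (m≤n+m a (1 + i * 3)) (≤-reflexive (sym w≡)))
    (≤-trans (s≤s (≤-reflexive w≡)) (≤-trans (n≤1+n _) (i<t⇒3+i*3+a≤t*3+a a i<t)))

  -- Dividing the offset `x` by 3 gives the triple containing `v` as quotient and the place of `v`
  -- in that triple as remainder.
  triples-covered : ∀ {D} a t → t * 3 + a ≤ n →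
    (∀ {w} → a ≤ toℕ w → toℕ w < t * 3 + a → w ∉ S) →
    (∀ {w : Fin n} → toℕ w ∈ˡ centres a t → w ∈ D) →
    ∀ {v} x → x < t * 3 → toℕ v ≡ x + a → Covered G D v
  triples-covered a t end≤n free centre∈D {v} x x<t*3 v≡ =
    triple-covered (≤-trans triple≤ end≤n)
      (λ a≤w w<a → free (≤-trans (m≤n+m a (i * 3)) a≤w) (≤-trans w<a triple≤))
      (λ w≡ → centre∈D (subst (_∈ˡ centres a t) (sym w≡)
                 (∈-applyUpTo⁺ (λ i → 1 + (i * 3 + a)) i<t)))
      (x % 3) (m%n<n x 3)
      (trans v≡ (trans (cong (_+ a) (m≡m%n+[m/n]*n x 3)) (+-assoc (x % 3) (i * 3) a)))
    where
    i = x / 3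

    i<t : i < t
    i<t = *-cancelʳ-< 3 i t (≤-<-trans (m/n*n≤m x 3) x<t*3)

    triple≤ : 3 + (i * 3 + a) ≤ t * 3 + a
    triple≤ = i<t⇒3+i*3+a≤t*3+a a i<t

  -- The path is read as `q` triples, a middle piece of `m` positions starting at `q * 3`, and `j`
  -- further triples. Every deletion falls in the middle, where `xs` lists the chosen positions;
  -- each triple contributes its centre.
  module _ (q j m : ℕ) (n≡ : n ≡ j * 3 + (m + q * 3))
           (S-middle : ∀ {v} → v ∈ S → q * 3 ≤ toℕ v × toℕ v < m + q * 3)
           (xs : List ℕ)
           (xs-free : ∀ {v : Fin n} → toℕ v ∈ˡ xs → v ∉ S)
           (middle-covered : ∀ {v} y → y < m → toℕ v ≡ y + q * 3 → v ∉ S →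
                             Covered G (positions xs) v)
           where

    private
      D-list : List ℕ
      D-list = centres 0 q ++ centres (m + q * 3) j ++ xs

      D : Subset n
      D = positions D-list

      left-free : ∀ {w} → 0 ≤ toℕ w → toℕ w < q * 3 + 0 → w ∉ S
      left-free _ w< w∈S = <⇒≱ w<
        (≤-trans (≤-reflexive (+-identityʳ (q * 3))) (proj₁ (S-middle w∈S)))

      right-free : ∀ {w} → m + q * 3 ≤ toℕ w → toℕ w < j * 3 + (m + q * 3) → w ∉ S
      right-free ≤w _ w∈S = <⇒≱ (proj₂ (S-middle w∈S)) ≤w

      D-free : ∀ {v} → toℕ v ∈ˡ D-list → v ∉ S
      D-free v∈ with ∈-++⁻ (centres 0 q) v∈
      ... | inj₁ v∈left = centre-free 0 q left-free v∈left
      ... | inj₂ v∈rest with ∈-++⁻ (centres (m + q * 3) j) v∈rest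
      ...   | inj₁ v∈right = centre-free (m + q * 3) j right-free v∈right
      ...   | inj₂ v∈xs    = xs-free v∈xs

      left-end≤n : q * 3 + 0 ≤ n
      left-end≤n = ≤-trans (≤-reflexive (+-identityʳ (q * 3)))
        (≤-trans (m≤n+m (q * 3) m) (≤-trans (m≤n+m (m + q * 3) (j * 3)) (≤-reflexive (sym n≡))))

      D-covers : ∀ {v} → v ∉ S → Covered G D v
      D-covers {v} v∉S with toℕ v <? q * 3
      ... | yes v<q*3 = triples-covered 0 q left-end≤n left-free
              (λ w∈ → ∈-positions⁺ {xs = D-list} (∈-++⁺ˡ w∈))
              (toℕ v) v<q*3 (sym (+-identityʳ (toℕ v)))
      ... | no v≮q*3 with toℕ v <? m + q * 3
      -- The choices in `xs` already cover the middle, and adding the centres of the triples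
      -- preserves this.
      ...   | yes v<m = Covered-mono G
              (λ w∈ → ∈-positions⁺ {xs = D-list}
                 (∈-++⁺ʳ (centres 0 q) (∈-++⁺ʳ (centres (m + q * 3) j) (∈-positions⁻ {xs = xs} w∈))))
              (middle-covered y (+-cancelʳ-< (q * 3) y m (subst (_< m + q * 3) v≡ v<m)) v≡ v∉S)
        where
        y = toℕ v ∸ q * 3
        v≡ : toℕ v ≡ y + q * 3
        v≡ = sym (m∸n+n≡m (≮⇒≥ v≮q*3))
      ...   | no v≮m = triples-covered (m + q * 3) j (≤-reflexive (sym n≡)) right-free
              (λ w∈ → ∈-positions⁺ {xs = D-list} (∈-++⁺ʳ (centres 0 q) (∈-++⁺ˡ w∈)))
              x (+-cancelʳ-< (m + q * 3) x (j * 3) (subst₂ _<_ v≡ n≡ (toℕ<n v))) v≡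
        where
        x = toℕ v ∸ (m + q * 3)
        v≡ : toℕ v ≡ x + (m + q * 3)
        v≡ = sym (m∸n+n≡m (≮⇒≥ v≮m))

      length-D : length D-list ≡ q + (j + length xs)
      length-D = begin
        length D-list
          ≡⟨ length-++ (centres 0 q) ⟩
        length (centres 0 q) + length (centres (m + q * 3) j ++ xs)
          ≡⟨ cong₂ _+_ (length-applyUpTo _ q) (length-++ (centres (m + q * 3) j)) ⟩
        q + (length (centres (m + q * 3) j) + length xs)
          ≡⟨ cong (λ l → q + (l + length xs)) (length-applyUpTo _ j) ⟩
        q + (j + length xs) ∎
        where open ≡-Reasoning

    γst≤triples+middle : γst G ≤ q + (j + length xs)
    γst≤triples+middle = ≤-trans
      (γst-lower G (covered⇒strongDominating G
        (∉⇒∈V ∘ D-free ∘ ∈-positions⁻ {xs = D-list}) (D-covers ∘ ∈V⇒∉)))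
      (≤-trans (∣p∣≤length D-list {D} (∈-positions⁻ {xs = D-list})) (≤-reflexive length-D))

-- Lower bounds from packings

path-packing≤γst : (S : Subset n) (e t : ℕ) →
  (∀ {i} → i < t → ∃ λ v → toℕ v + e ≡ 1 + i * 3 × v ∉ S) → t ≤ γst (Path n ∖ S)
path-packing≤γst {n} S e t pick = packing≤γst (Path n ∖ S) (class S e) t λ {i} i<t →
  let (v , v≡ , v∉S) = pick i<t in v , path-packing S e i v≡ v∉S

-- The packing 0, 3, 6, …
multiples≤γst : (S : Subset n) (t : ℕ) → t * 3 < 3 + n →
  (∀ {i v} → toℕ v ≡ i * 3 → v ∉ S) → t ≤ γst (Path n ∖ S)
multiples≤γst {n} S t t*3<3+n free = path-packing≤γst S 1 t λ {i} i<t →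
  -- The bound on `t` says exactly that the last centre, three less than `t * 3`, lies on the path.
  let v , v≡ = vertex (+-cancelˡ-< 3 (i * 3) n (≤-<-trans (*-monoˡ-≤ 3 i<t) t*3<3+n)) in
  v , trans (cong (_+ 1) v≡) (+-comm (i * 3) 1) , free {i} v≡

-- The packing 1, 4, 7, …
multiples+1≤γst : (S : Subset n) (t : ℕ) → t * 3 < 2 + n →
  (∀ {i v} → toℕ v ≡ 1 + i * 3 → v ∉ S) → t ≤ γst (Path n ∖ S)
multiples+1≤γst {n} S t t*3<2+n free = path-packing≤γst S 0 t λ {i} i<t →
  let v , v≡ = vertex (+-cancelˡ-< 2 (1 + i * 3) n (≤-<-trans (*-monoˡ-≤ 3 i<t) t*3<2+n)) in
  v , trans (+-identityʳ (toℕ v)) v≡ , free {i} v≡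

∉⁅⁆ : {u v : Fin n} → toℕ u ≢ toℕ v → u ∉ ⁅ v ⁆
∉⁅⁆ {v = v} u≢v u∈ = u≢v (cong toℕ (x∈⁅y⁆⇒x≡y v u∈))

∈⁅⁆ : {u v : Fin n} → toℕ u ≡ toℕ v → u ∈ ⁅ v ⁆
∈⁅⁆ {v = v} u≡v = subst (_∈ ⁅ v ⁆) (sym (toℕ-injective u≡v)) (x∈⁅x⁆ v)

-- n stays a variable constrained by an equation, so that γst does not unfold.

module _ (k : ℕ) (n≡ : n ≡ k * 3) where

  γst-path[3k]≤k : γst (Path n) ≤ k
  γst-path[3k]≤k = subst (_≤ k) (γst-∖⊥ (Path n)) (≤-trans
    -- All triples stand on the left of an empty middle, so the required length equation reduces to
    -- `n≡`.
    (γst≤triples+middle ⊥ k 0 0 n≡ (λ v∈⊥ → contradiction v∈⊥ ∉⊥) [] (λ ()) (λ y ()))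
    (≤-reflexive (+-identityʳ k)))

  -- Deleting vertex 1 isolates vertex 0, which joins the packing 2, 5, 8, …
  k<γst-path[3k]∖1 : {v : Fin n} → toℕ v ≡ 1 → suc k ≤ γst (Path n ∖ ⁅ v ⁆)
  k<γst-path[3k]∖1 {v} v≡1 = packing≤γst (Path n ∖ ⁅ v ⁆) (class ⁅ v ⁆ 2) (suc k) pick
    where
    pick : ∀ {i} → i < suc k → ∃ λ u → u ∈ V (Path n ∖ ⁅ v ⁆) × class ⁅ v ⁆ 2 u ≡ i ×
           (∀ {w} → Adj (Path n ∖ ⁅ v ⁆) u w → class ⁅ v ⁆ 2 w ≡ i)
    -- With shift 2, class 0 holds only vertex 0. Its one possible neighbour is deleted, so the
    -- condition on neighbours is vacuous.
    pick {zero} _ =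
      let u , u≡0 = vertex (≤-<-trans z≤n (toℕ<n v)) in
      u , ∉⇒∈V ⁅ v ⁆ (∉⁅⁆ λ u≡v → 1+n≢0 (trans (sym v≡1) (trans (sym u≡v) u≡0)))
        , cong (λ u → (u + 2) / 3) u≡0
        , λ where
            (inj₁ w≡1+u , _ , w∉) →
              contradiction (∈⁅⁆ (trans w≡1+u (trans (cong suc u≡0) (sym v≡1)))) w∉
            (inj₂ u≡1+w , _) → contradiction (trans (sym u≡1+w) u≡0) 1+n≢0
    pick {suc i} (s≤s i<k) =
      let u , u≡ = vertex (≤-trans (*-monoˡ-≤ 3 i<k) (≤-reflexive (sym n≡))) in
      u , path-packing ⁅ v ⁆ 2 (suc i) (trans (cong (_+ 2) u≡) (+-comm (2 + i * 3) 2))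
            (∉⁅⁆ λ u≡v → 1+n≢0 (suc-injective (trans (sym u≡) (trans u≡v v≡1))))

  stability-path[3k] : 3 ≤ n → stability (Path n) ≡ 1
  stability-path[3k] 3≤n =
    let v , v≡1 = vertex (≤-trans (n≤1+n 2) 3≤n) in
    stability≡1 (Path n) {v} ∈⊤ (>⇒≢ (≤-<-trans γst-path[3k]≤k (k<γst-path[3k]∖1 v≡1)))

-- Paths on 3k + 1 vertices

module _ (k : ℕ) (n≡ : n ≡ 1 + k * 3) where

  -- The packing 0, 3, ..., 3k reaches the last vertex and so has k + 1 members.
  k<γst-path[3k+1] : k < γst (Path n)
  k<γst-path[3k+1] = subst (k <_) (γst-∖⊥ (Path n))
    (multiples≤γst ⊥ (suc k) (+-monoʳ-≤ 3 (≤-reflexive (sym n≡)))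
      (λ _ → ∉⊥))

  -- The middle piece is the deleted vertex alone; what follows splits into k triples.
  γst-path[3k+1]∖0≤k : {v : Fin n} → toℕ v ≡ 0 → γst (Path n ∖ ⁅ v ⁆) ≤ k
  γst-path[3k+1]∖0≤k {v} v≡0 = ≤-trans
    (γst≤triples+middle ⁅ v ⁆ 0 k 1 (trans n≡ (+-comm 1 (k * 3))) S-middle [] (λ ()) middle)
    (≤-reflexive (+-identityʳ k))
    where
    S-middle : ∀ {u} → u ∈ ⁅ v ⁆ → 0 ≤ toℕ u × toℕ u < 1
    S-middle u∈ =
      z≤n , s≤s (≤-reflexive (trans (cong toℕ (x∈⁅y⁆⇒x≡y v u∈)) v≡0))

    middle : ∀ {u} y → y < 1 → toℕ u ≡ y + 0 → u ∉ ⁅ v ⁆ →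
             Covered (Path n ∖ ⁅ v ⁆) (positions []) u
    middle 0 _ u≡0 u∉ = contradiction (∈⁅⁆ (trans u≡0 (sym v≡0))) u∉
    middle (suc _) (s≤s ()) _ _

  stability-path[3k+1] : stability (Path n) ≡ 1
  stability-path[3k+1] =
    let v , v≡0 = vertex (subst (0 <_) (sym n≡) z<s) in
    stability≡1 (Path n) {v} ∈⊤ (<⇒≢ (≤-<-trans (γst-path[3k+1]∖0≤k v≡0) k<γst-path[3k+1]))

-- Paths on 3k + 2 vertices

module _ (k : ℕ) (n≡ : n ≡ 2 + k * 3) where

  -- The two deleted vertices make up the whole middle piece, so nothing is chosen there.
  γst-path[3k+2]∖01≤k : {u v : Fin n} → toℕ u ≡ 0 → toℕ v ≡ 1 →
                        γst (Path n ∖ (⁅ u ⁆ ∪ ⁅ v ⁆)) ≤ k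
  γst-path[3k+2]∖01≤k {u} {v} u≡0 v≡1 = ≤-trans
    (γst≤triples+middle S 0 k 2 (trans n≡ (+-comm 2 (k * 3))) S-middle [] (λ ()) middle)
    (≤-reflexive (+-identityʳ k))
    where
    S : Subset n
    S = ⁅ u ⁆ ∪ ⁅ v ⁆

    S-middle : ∀ {w} → w ∈ S → 0 ≤ toℕ w × toℕ w < 2
    S-middle w∈ with x∈p∪q⁻ ⁅ u ⁆ ⁅ v ⁆ w∈
    ... | inj₁ w∈u = z≤n , s≤s (m≤n⇒m≤1+n (≤-reflexive (trans (cong toℕ (x∈⁅y⁆⇒x≡y u w∈u)) u≡0)))
    ... | inj₂ w∈v = z≤n , s≤s (≤-reflexive (trans (cong toℕ (x∈⁅y⁆⇒x≡y v w∈v)) v≡1))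

    middle : ∀ {w} y → y < 2 → toℕ w ≡ y + 0 → w ∉ S → Covered (Path n ∖ S) (positions []) w
    middle 0 _ w≡0 w∉ = contradiction (x∈p∪q⁺ (inj₁ (∈⁅⁆ (trans w≡0 (sym u≡0))))) w∉
    middle 1 _ w≡1 w∉ = contradiction (x∈p∪q⁺ {p = ⁅ u ⁆} (inj₂ (∈⁅⁆ (trans w≡1 (sym v≡1))))) w∉
    middle (suc (suc _)) (s≤s (s≤s ())) _ _

  -- Room for the packing 0, 3, ..., 3k, which ends at the last vertex but one.
  1+k-multiples : suc k * 3 < 3 + n
  1+k-multiples = +-monoʳ-≤ 3 (≤-trans (n≤1+n _) (≤-reflexive (sym n≡)))

  -- After k triples two vertices remain; the first of them is chosen and dominates the other, which
  -- is the end of the path and hence a leaf. The packing of multiples of 3 gives the matching lower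
  -- bound.
  γst-path[3k+2] : γst (Path n) ≡ suc k
  γst-path[3k+2] = trans (sym (γst-∖⊥ (Path n))) (≤-antisym upper lower)
    where
    lower : suc k ≤ γst (Path n ∖ ⊥)
    lower = multiples≤γst ⊥ (suc k) 1+k-multiples (λ _ → ∉⊥)

    middle : ∀ {v} y → y < 2 → toℕ v ≡ y + k * 3 → v ∉ ⊥ →
             Covered (Path n ∖ ⊥) (positions (k * 3 ∷ [])) v
    middle 0 _ v≡ _ = inj₁ (∈-positions⁺ {xs = _ ∷ []} (here v≡))
    middle {v} 1 _ v≡ _ with vertex {a = k * 3} (≤-trans (n≤1+n _) (≤-reflexive (sym n≡)))
    ... | u , u≡ = leaf-covered (Path n ∖ ⊥) (∈-positions⁺ {xs = _ ∷ []} (here u≡))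
      (inj₂ (trans v≡ (cong suc (sym u≡))) , ∉⊥ , ∉⊥) λ where
        (inj₂ v≡1+w , _) →
          toℕ-injective (trans (suc-injective (trans (sym v≡1+w) v≡)) (sym u≡))
        -- A right neighbour would stand at position `n`, outside the path.
        {w} (inj₁ w≡1+v , _) → contradiction (toℕ<n w)
          (≤⇒≯ (≤-reflexive (trans n≡ (sym (trans w≡1+v (cong suc v≡))))))
    middle (suc (suc _)) (s≤s (s≤s ())) _ _

    upper : γst (Path n ∖ ⊥) ≤ suc k
    upper = ≤-trans
      (γst≤triples+middle ⊥ k 0 2 n≡ (λ v∈⊥ → contradiction v∈⊥ ∉⊥) (k * 3 ∷ [])
        (λ _ → ∉⊥) middle)
      (≤-reflexive (+-comm k 1))

  module _ (v : Fin n) where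

    private
      S : Subset n
      S = ⁅ v ⁆

      G : Graph n
      G = Path n ∖ S

      v< : ∀ {a} → toℕ v ≡ a → a < 2 + k * 3
      v< v≡ = subst₂ _<_ v≡ n≡ (toℕ<n v)

    -- Both 0, 3, ..., 3k and 1, 4, ..., 3k + 1 are packings with k + 1 members; one whose residue
    -- modulo 3 differs from that of `v` survives the deletion.
    lower : ∀ r q → r < 3 → toℕ v ≡ r + q * 3 → suc k ≤ γst G
    lower 0 q _ v≡ = multiples+1≤γst S (suc k)
      (+-monoʳ-≤ 2 (≤-reflexive (sym n≡))) λ {i} u≡ → ∉⁅⁆ λ u≡v →
        contradiction (residue-unique 1 0 i q (trans (sym u≡) (trans u≡v v≡))) λ ()
    lower 1 q _ v≡ = multiples≤γst S (suc k) 1+k-multiples λ {i} u≡ → ∉⁅⁆ λ u≡v →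
      contradiction (residue-unique 0 1 i q (trans (sym u≡) (trans u≡v v≡))) λ ()
    lower 2 q _ v≡ = multiples≤γst S (suc k) 1+k-multiples λ {i} u≡ → ∉⁅⁆ λ u≡v →
      contradiction (residue-unique 0 2 i q (trans (sym u≡) (trans u≡v v≡))) λ ()
    lower (suc (suc (suc _))) _ (s≤s (s≤s (s≤s ()))) _

    module _ (q : ℕ) where

      private
        S-middle : ∀ r m → r < m → toℕ v ≡ r + q * 3 →
                   ∀ {u} → u ∈ S → q * 3 ≤ toℕ u × toℕ u < m + q * 3
        S-middle r m r<m v≡ u∈S rewrite x∈⁅y⁆⇒x≡y v u∈S | v≡ =
          m≤n+m (q * 3) r , +-monoˡ-< (q * 3) r<m

        ≢v : ∀ {r} s → s ≢ r → toℕ v ≡ r + q * 3 → ∀ {u : Fin n} → toℕ u ≡ s + q * 3 →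
             u ∉ S
        ≢v {r} s s≢r v≡ u≡ = ∉⁅⁆ λ u≡v →
          s≢r (+-cancelʳ-≡ (q * 3) s r (trans (sym u≡) (trans u≡v v≡)))

      -- The leftover vertex sits next to the deleted one, between whole triples.
      upper-01 : ∀ r s → r < 2 → s ≢ r → (∀ y → y < 2 → y ≡ r ⊎ y ≡ s) →
                 toℕ v ≡ r + q * 3 → q ≤ k → γst G ≤ suc k
      upper-01 r s r<2 s≢r r-or-s v≡ q≤k = ≤-trans
        (γst≤triples+middle S q j 2 n≡′ (S-middle r 2 r<2 v≡) (s + q * 3 ∷ [])
          (λ where (here u≡) → ≢v s s≢r v≡ u≡) middle)
        (≤-reflexive size)
        where
        j = k ∸ q

        j+q≡k : j + q ≡ k
        j+q≡k = m∸n+n≡m q≤k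

        n≡′ : n ≡ j * 3 + (2 + q * 3)
        n≡′ = trans n≡ (trans (cong (λ k → 2 + k * 3) (sym j+q≡k)) (regroup j q))
          where
          regroup : ∀ j q → 2 + (j + q) * 3 ≡ j * 3 + (2 + q * 3)
          regroup = solve-∀

        size : q + (j + 1) ≡ suc k
        size = trans (regroup j q) (cong suc j+q≡k)
          where
          regroup : ∀ j q → q + (j + 1) ≡ 1 + (j + q)
          regroup = solve-∀

        middle : ∀ {u} y → y < 2 → toℕ u ≡ y + q * 3 → u ∉ S →
                 Covered G (positions (s + q * 3 ∷ [])) u
        middle y y<2 u≡ u∉S with r-or-s y y<2
        ... | inj₁ refl = contradiction (∈⁅⁆ (trans u≡ (sym v≡))) u∉S
        ... | inj₂ refl = inj₁ (∈-positions⁺ {xs = _ ∷ []} (here u≡))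

      -- Two leftover vertices on each side of the deleted one; in each pair the outer
      -- one dominates the inner one, which has become a leaf.
      upper-2 : toℕ v ≡ 2 + q * 3 → q < k → γst G ≤ suc k
      upper-2 v≡ q<k = ≤-trans
        (γst≤triples+middle S q j 5 n≡′ (S-middle 2 5 (s<s (s<s z<s)) v≡) xs xs-free middle)
        (≤-reflexive size)
        where
        -- The middle of length 5 consists of the two surplus positions and one whole triple, so one
        -- triple fewer remains on the right.
        j = k ∸ suc q

        j+1+q≡k : j + suc q ≡ k
        j+1+q≡k = m∸n+n≡m q<k

        n≡′ : n ≡ j * 3 + (5 + q * 3)
        n≡′ = trans n≡ (trans (cong (λ k → 2 + k * 3) (sym j+1+q≡k)) (regroup j q))
          where
          regroup : ∀ j q → 2 + (j + (1 + q)) * 3 ≡ j * 3 + (5 + q * 3)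
          regroup = solve-∀

        size : q + (j + 2) ≡ suc k
        size = trans (regroup j q) (cong suc j+1+q≡k)
          where
          regroup : ∀ j q → q + (j + 2) ≡ 1 + (j + (1 + q))
          regroup = solve-∀

        5+q*3≤n : 5 + q * 3 ≤ n
        5+q*3≤n = ≤-trans (m≤n+m _ (j * 3)) (≤-reflexive (sym n≡′))

        xs : List ℕ
        xs = q * 3 ∷ 4 + q * 3 ∷ []

        xs-free : ∀ {u : Fin n} → toℕ u ∈ˡ xs → u ∉ S
        xs-free (here u≡)         = ≢v 0 (λ ()) v≡ u≡
        xs-free (there (here u≡)) = ≢v 4 (λ ()) v≡ u≡

        middle : ∀ {u} y → y < 5 → toℕ u ≡ y + q * 3 → u ∉ S → Covered G (positions xs) u
        middle 0 _ u≡ _ = inj₁ (∈-positions⁺ {xs = xs} (here u≡))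
        middle 1 _ u≡ u∉S with vertex {a = q * 3} (≤-trans (s≤s (m≤n+m _ 4)) 5+q*3≤n)
        ... | w , w≡ = leaf-covered G {u = w} (∈-positions⁺ {xs = xs} (here w≡))
          (inj₂ (trans u≡ (cong suc (sym w≡))) , u∉S , xs-free (here w≡)) λ where
            (inj₁ x≡1+u , _ , x∉S) → contradiction
              (∈⁅⁆ (trans x≡1+u (trans (cong suc u≡) (sym v≡)))) x∉S
            (inj₂ u≡1+x , _) →
              toℕ-injective (trans (suc-injective (trans (sym u≡1+x) u≡)) (sym w≡))
        middle 2 _ u≡ u∉S = contradiction (∈⁅⁆ (trans u≡ (sym v≡))) u∉S
        middle 3 _ u≡ u∉S with vertex {a = 4 + q * 3} 5+q*3≤n
        ... | w , w≡ = leaf-covered G {u = w} (∈-positions⁺ {xs = xs} (there (here w≡)))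
          (inj₁ (trans w≡ (cong suc (sym u≡))) , u∉S , xs-free (there (here w≡))) λ where
            (inj₁ x≡1+u , _) →
              toℕ-injective (trans x≡1+u (trans (cong suc u≡) (sym w≡)))
            (inj₂ u≡1+x , _ , x∉S) → contradiction
              (∈⁅⁆ (trans (suc-injective (trans (sym u≡1+x) u≡)) (sym v≡))) x∉S
        middle 4 _ u≡ _ = inj₁ (∈-positions⁺ {xs = xs} (there (here u≡)))
        middle (suc (suc (suc (suc (suc _))))) (s≤s (s≤s (s≤s (s≤s (s≤s ()))))) _ _

    -- The residue of `v` selects the shape of the middle, and `v` being on the path makes it fit:
    -- residues 0 and 1 give q ≤ k, enough for length 2, while residue 2 gives q < k, enough for
    -- length 5.
    upper : ∀ r q → r < 3 → toℕ v ≡ r + q * 3 → γst G ≤ suc k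
    upper 0 q _ v≡ = upper-01 q 0 1 z<s (λ ())
      (λ where
        0 _ → inj₁ refl
        1 _ → inj₂ refl
        (suc (suc _)) (s≤s (s≤s ())))
      v≡ (s≤s⁻¹ (*-cancelʳ-< 3 q (suc k) (<-≤-trans (v< v≡) (n≤1+n _))))
    upper 1 q _ v≡ = upper-01 q 1 0 (s<s z<s) (λ ())
      (λ where
        0 _ → inj₂ refl
        1 _ → inj₁ refl
        (suc (suc _)) (s≤s (s≤s ())))
      v≡ (*-cancelʳ-≤ q k 3 (s≤s⁻¹ (s≤s⁻¹ (v< v≡))))
    upper 2 q _ v≡ = upper-2 q v≡
      (*-cancelʳ-< 3 q k (+-cancelˡ-< 2 (q * 3) (k * 3) (v< v≡)))
    upper (suc (suc (suc _))) _ (s≤s (s≤s (s≤s ()))) _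

    γst-path[3k+2]∖v : γst G ≡ suc k
    γst-path[3k+2]∖v = ≤-antisym
      (upper (toℕ v % 3) (toℕ v / 3) (m%n<n (toℕ v) 3) v≡)
      (lower (toℕ v % 3) (toℕ v / 3) (m%n<n (toℕ v) 3) v≡)
      where
      v≡ : toℕ v ≡ toℕ v % 3 + toℕ v / 3 * 3
      v≡ = m≡m%n+[m/n]*n (toℕ v) 3

  stability-path[3k+2] : stability (Path n) ≡ 2
  stability-path[3k+2] =
    let u , u≡0 = vertex (subst (0 <_) (sym n≡) z<s)
        v , v≡1 = vertex (subst (1 <_) (sym n≡) (s<s z<s))
        changes = <⇒≢ (≤-trans (s≤s (γst-path[3k+2]∖01≤k u≡0 v≡1))
                               (≤-reflexive (sym γst-path[3k+2])))
    in ≤-antisym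
      (≤-trans (stability-lower (Path n) {⁅ u ⁆ ∪ ⁅ v ⁆} ((λ _ → ∈⊤) , changes))
        (≤-trans (∣p∪q∣≤∣p∣+∣q∣ ⁅ u ⁆ ⁅ v ⁆)
          (≤-reflexive (cong₂ _+_ (∣⁅x⁆∣≡1 u) (∣⁅x⁆∣≡1 v)))))
      (1<stability (Path n) (u , ∈⊤) λ w →
        trans (γst-path[3k+2]∖v w) (sym γst-path[3k+2]))

-- The three residues combined

proposition2p2 : ∀ (n : ℕ) → 3 ≤ n →
    ((n % 3 ≡ 0 ⊎ n % 3 ≡ 1) → stability (Path n) ≡ 1) ×
    (n % 3 ≡ 2 → stability (Path n) ≡ 2)
proposition2p2 n 3≤n = one , two
  where
  n≡ : ∀ {r} → n % 3 ≡ r → n ≡ r + n / 3 * 3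
  n≡ n%3≡r = trans (m≡m%n+[m/n]*n n 3) (cong (_+ n / 3 * 3) n%3≡r)

  one : n % 3 ≡ 0 ⊎ n % 3 ≡ 1 → stability (Path n) ≡ 1
  one (inj₁ n%3≡0) = stability-path[3k] (n / 3) (n≡ n%3≡0) 3≤n
  one (inj₂ n%3≡1) = stability-path[3k+1] (n / 3) (n≡ n%3≡1)

  two : n % 3 ≡ 2 → stability (Path n) ≡ 2
  two n%3≡2 = stability-path[3k+2] (n / 3) (n≡ n%3≡2)
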